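{- For every integer $t\ge 2$, there exists a $(12t+10,3,2)$-BIBD $(X,\mathcal{A})$ with a weak nesting $\phi:\mathcal{A}\to Y$, $X\subseteq Y$, where $|Y|=w=14t+13$.
   Context: A $(v,k,\lambda)$-BIBD is a pair $(X,\mathcal{A})$ where $X$ is a set of $v$ points and $\mathcal{A}$ is a multiset of $k$-subsets of $X$ (blocks) such that every pair of distinct points lies in exactly $\lambda$ blocks. A partial $(w,k,\lambda)$-BIBD is defined in the same way on $w$ points, except that every pair lies in at most $\lambda$ blocks. Given a $(v,k,\lambda)$-BIBD $(X,\mathcal{A})$ and a set $Y\supseteq X$ with $|Y|=w$, a map $\phi:\mathcal{A}\to Y$ is a weak nesting if $\phi(A)\notin A$ for every block $A$ and the multiset $\{A\cup\{\phi(A)\}:A\in\mathcal{A}\}$ is a partial $(w,k+1,\lambda+1)$-BIBD on $Y$. -}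

module Defs where

open import Data.Fin using (Fin)
open import Data.Fin.Subset using (Subset; _∈_; _∉_; _⊆_; _∪_; ⁅_⁆; ∣_∣)
open import Data.Fin.Subset.Properties using (_∈?_)
open import Data.List using (length; filter; allFin)
open import Data.Nat using (ℕ; suc; _≤_)
open import Data.Vec.Functional using (Vector)
open import Level using (0ℓ)
open import Relation.Binary using (Rel)
open import Relation.Binary.PropositionalEquality using (_≡_; _≢_)
open import Relation.Nullary.Decidable using (_×-dec_)

-- Point sets are subsets of an ambient finite set `Fin n`.  A multiset of
-- blocks is a family indexed by `Fin b`: repeated blocks are repeated values,
-- so every count below is a count with multiplicity.
Blocks : ℕ → ℕ → Set
Blocks n b = Vector (Subset n) b

pairCount : ∀ {n b} → Blocks n b → Fin n → Fin n → ℕ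
pairCount {b = b} 𝒜 x y =
  length (filter (λ i → (x ∈? 𝒜 i) ×-dec (y ∈? 𝒜 i)) (allFin b))

-- The relation `_∼_` compares the pair counts with λ′: equality gives a BIBD,
-- `_≤_` a partial one.
record IsDesign (_∼_ : Rel ℕ 0ℓ) (v k λ′ : ℕ) {n b : ℕ}
                (X : Subset n) (𝒜 : Blocks n b) : Set where
  field
    order     : ∣ X ∣ ≡ v
    block⊆X   : ∀ i → 𝒜 i ⊆ X
    blockSize : ∀ i → ∣ 𝒜 i ∣ ≡ k
    pairs     : ∀ {x y} → x ∈ X → y ∈ X → x ≢ y → pairCount 𝒜 x y ∼ λ′

IsBIBD : (v k λ′ : ℕ) {n b : ℕ} → Subset n → Blocks n b → Set
IsBIBD = IsDesign _≡_

IsPartialBIBD : (w k λ′ : ℕ) {n b : ℕ} → Subset n → Blocks n b → Set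
IsPartialBIBD = IsDesign _≤_

-- φ is defined on block occurrences: two copies of the same block may be sent
-- to different points.
nest : ∀ {n b} → Blocks n b → (Fin b → Fin n) → Blocks n b
nest 𝒜 φ i = 𝒜 i ∪ ⁅ φ i ⁆

record IsWeakNesting (v w k λ′ : ℕ) {n b : ℕ} (X Y : Subset n)
                     (𝒜 : Blocks n b) (φ : Fin b → Fin n) : Set where
  field
    bibd    : IsBIBD v k λ′ X 𝒜
    X⊆Y     : X ⊆ Y
    ∣Y∣≡w   : ∣ Y ∣ ≡ w
    φ∈Y     : ∀ i → φ i ∈ Y
    φ∉block : ∀ i → φ i ∉ 𝒜 i
    partial : IsPartialBIBD w (suc k) (suc λ′) Y (nest 𝒜 φ)

{-# OPTIONS --safe #-}

-- Let m = 4t + 3 and take three rows of columns ℤ/m together with a point ∞.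
-- For every column g, row r and e ≠ 0 there is a triangle {(g−e, r), (g+e, r), (g, r+1)};
-- since 2 is invertible modulo m, the triangles cover twice every pair of points in
-- different columns.  The blocks {∞, (g, r), (g, r+1)} and {(g, 0), (g, 1), (g, 2)}
-- cover the remaining pairs.
--
-- For e = 3j+1 and e = 3j+3 with j < t the triangle is nested by the point (g+s, r+1),
-- where s = t−j and s = t+j+1 respectively; the block {∞, (g, r), (g, r+1)} is nested by
-- (g+u, r+2) with u = 3t+1.  Each of the 2t+2 other values of e has its own new point, and
-- the columns share one more.  Every pair within X is then created at most once:
-- the shifts s are distinct up to sign, and the differences s+e, s−e, u, −u between
-- adjacent rows are distinct modulo m, being of the form 2χ+1−3t with distinct 0 ≤ χ < m.

module Submission where

open import Data.Fin using (Fin; zero; suc; _↑ˡ_; _↑ʳ_; join; splitAt; toℕ; fromℕ<; combine; opposite)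
open import Data.Fin.Patterns using (0F; 1F; 2F)
open import Data.Fin.Properties
  using (_≟_; +↔⊎; *↔×; 1↔⊤; injective⇒≤; join-splitAt; toℕ<n; toℕ-fromℕ<; toℕ-injective;
         toℕ-↑ˡ; toℕ-↑ʳ; toℕ-combine; opposite-prop; opposite-involutive; suc-injective)
open import Data.Fin.Subset
  using (Subset; inside; outside; _∈_; _∉_; _⊆_; _∪_; ⁅_⁆; ∣_∣; ⊤; ⊥)
open import Data.Fin.Subset.Properties
  using (x∈⁅x⁆; x∈⁅y⁆⇒x≡y; ∣⁅x⁆∣≡1; ∣⊥∣≡0; ∪-identityʳ; x∈p∪q⁻; x∈p∪q⁺; ∉⊥; ∈⊤; ∣⊤∣≡n)
open import Data.Integer as ℤ using (ℤ; +_; -_; _-_; _%ℕ_; _/ℕ_)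
open import Data.Integer.DivMod using (n%ℕd<d; a≡a%ℕn+[a/ℕn]*n)
open import Data.Integer.Divisibility.Signed
  using (_∣_; divides; ∣⇒∣ᵤ; ∣-refl; ∣m∣n⇒∣m+n; ∣n⇒∣m*n)
open import Data.Integer.Properties using (m-n≡m⊖n; ⊖-≥; pos-*)
open import Data.Integer.Solver using (module +-*-Solver)
open import Data.List using (List; length; filter; allFin; lookup)
open import Data.List.Membership.Propositional using () renaming (_∈_ to _∈ˡ_)
open import Data.List.Membership.Propositional.Properties using (∈-filter⁺; ∈-allFin; ∈-lookup)
open import Data.List.Membership.Setoid.Properties using (index-injective)
open import Data.List.Relation.Unary.All as All using ()
open import Data.List.Relation.Unary.All.Properties using (all-filter)
open import Data.List.Relation.Unary.AllPairs using (_∷_)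
open import Data.List.Relation.Unary.Any using (index)
open import Data.List.Relation.Unary.Unique.Propositional using (Unique)
open import Data.List.Relation.Unary.Unique.Propositional.Properties using (allFin⁺; filter⁺)
open import Data.Nat
  using (ℕ; zero; suc; _+_; _*_; _∸_; _≤_; _<_; z≤n; s≤s; z<s; NonZero)
import Data.Nat.Divisibility as ℕ
import Data.Nat.Properties as ℕ
open import Data.Nat.Properties
  using (≤-antisym; ≤-trans; ≤-<-trans; ≤-total; m∸n≡0⇒m≤n; m∸n≤m; m+[n∸m]≡n; m≤m+n;
         +-mono-≤; 1+n≰n)
open import Data.Nat.Tactic.RingSolver using () renaming (solve-∀ to ℕ-solve-∀)
open import Data.Product using (Σ-syntax; ∃-syntax; _×_; _,_; proj₁; proj₂; swap)
open import Data.Product.Function.NonDependent.Propositional using (_×-↔_)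
open import Data.Sum as Sum using (_⊎_; inj₁; inj₂; [_,_]′)
open import Data.Sum.Function.Propositional using (_⊎-↔_)
open import Data.Sum.Properties using (inj₁-injective; inj₂-injective)
open import Data.Unit using (tt) renaming (⊤ to Unit)
open import Data.Vec using (_∷_; here; there) renaming (_++_ to _++ᵛ_)
open import Function using (_∘_; id; _↔_; Inverse; Injective; Injection)
open import Function.Properties.Inverse using (↔-sym; ↔-trans; ↔-refl; ↔⇒↣)
open import Relation.Binary using (DecidableEquality)
open import Relation.Binary.PropositionalEquality
open import Relation.Nullary using (¬_; contradiction; yes; no)
open import Relation.Unary using (Decidable)
open import Defs

-- Counting indices by injections.

↔-injective : ∀ {A B : Set} (f : A ↔ B) → Injective _≡_ _≡_ (Inverse.to f)
↔-injective f = Injection.injective (↔⇒↣ f)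

lookup-injective : ∀ {A : Set} {xs : List A} → Unique xs →
                   Injective _≡_ _≡_ (lookup xs)
lookup-injective (_ ∷ _) {zero}  {zero}  _  = refl
lookup-injective (x∉ ∷ _) {zero}  {suc j} eq = contradiction eq (All.lookup x∉ (∈-lookup j))
lookup-injective (x∉ ∷ _) {suc i} {zero}  eq = contradiction (sym eq) (All.lookup x∉ (∈-lookup i))
lookup-injective (_ ∷ u) {suc i} {suc j} eq = cong suc (lookup-injective u eq)

module _ {b : ℕ} {P : Fin b → Set} (P? : Decidable P) where

  private
    satisfying = filter P? (allFin b)

  -- The filtered list inherits distinctness from `allFin b`, so its positions inject into `Fin k`.
  -- Since `f` reads the proof of `P i`, injectivity is asked across arbitrary proofs.
  count≤ : ∀ {k} (f : ∀ {i} → P i → Fin k) →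
           (∀ {i j} (p : P i) (q : P j) → f p ≡ f q → i ≡ j) →
           length satisfying ≤ k
  count≤ f f-inj = injective⇒≤ {f = λ c → f (holds c)} λ eq →
    lookup-injective (filter⁺ P? (allFin⁺ b)) (f-inj (holds _) (holds _) eq)
    where
    holds : ∀ c → P (lookup satisfying c)
    holds c = All.lookup (all-filter P? (allFin b)) (∈-lookup c)

  count≥ : ∀ {k} (g : Fin k → Fin b) → Injective _≡_ _≡_ g → (∀ c → P (g c)) →
           k ≤ length satisfying
  count≥ g g-inj Pg = injective⇒≤ {f = λ c → index (mem c)} λ eq →
    g-inj (index-injective (setoid (Fin b)) (mem _) (mem _) eq)
    where
    mem : ∀ c → g c ∈ˡ satisfying
    mem c = ∈-filter⁺ P? (∈-allFin (g c)) (Pg c)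

-- Sizes of subsets and initial segments.

∣p∪⁅x⁆∣ : ∀ {n} (p : Subset n) (x : Fin n) → x ∉ p → ∣ p ∪ ⁅ x ⁆ ∣ ≡ suc ∣ p ∣
∣p∪⁅x⁆∣ (inside ∷ p)  zero    x∉ = contradiction here x∉
∣p∪⁅x⁆∣ (outside ∷ p) zero    x∉ = cong (suc ∘ ∣_∣) (∪-identityʳ p)
∣p∪⁅x⁆∣ (inside ∷ p)  (suc x) x∉ = cong suc (∣p∪⁅x⁆∣ p x (x∉ ∘ there))
∣p∪⁅x⁆∣ (outside ∷ p) (suc x) x∉ = ∣p∪⁅x⁆∣ p x (x∉ ∘ there)

initial : ∀ p o → Subset (p + o)
initial p o = ⊤ {p} ++ᵛ ⊥ {o}

∣initial∣ : ∀ p o → ∣ initial p o ∣ ≡ p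
∣initial∣ 0       o = ∣⊥∣≡0 o
∣initial∣ (suc p) o = cong suc (∣initial∣ p o)

↑ˡ∈initial : ∀ {p} (i : Fin p) o → i ↑ˡ o ∈ initial p o
↑ˡ∈initial zero    o = here
↑ˡ∈initial (suc i) o = there (↑ˡ∈initial i o)

∈initial⇒↑ˡ : ∀ p {o x} → x ∈ initial p o → ∃[ i ] x ≡ i ↑ˡ o
∈initial⇒↑ˡ 0       x∈         = contradiction x∈ ∉⊥
∈initial⇒↑ˡ (suc p) here       = zero , refl
∈initial⇒↑ˡ (suc p) (there x∈) with i , refl ← ∈initial⇒↑ˡ p x∈ = suc i , refl

-- Nested twofold triple systems with arbitrary labels, and their realisation on a finite set.

record TwoSolutions {I : Set} (P : I → Set) : Set where
  constructor two
  field
    {i₀ i₁}  : I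
    i₀≢i₁    : i₀ ≢ i₁
    P₀       : P i₀
    P₁       : P i₁
    complete : ∀ {i} → P i → i ≡ i₀ ⊎ i ≡ i₁

two-map : ∀ {I} {P Q : I → Set} → (∀ {i} → P i → Q i) → (∀ {i} → Q i → P i) →
          TwoSolutions P → TwoSolutions Q
two-map f g (two ne p q c) = two ne (f p) (f q) (c ∘ g)

module Labelled
  {P I O : Set} (pts : I → Fin 3 → P) (ψ : I → P ⊎ O) where

  In : P → I → Set
  In x i = ∃[ k ] pts i k ≡ x

  -- The bound 3 has two sources. A pair of old points lies in two blocks and may be created once
  -- more, in either orientation: this is `inner-once`. A pair with a new point arises only by
  -- nesting, and `outer-once` lets each of the three positions of a block hold the old point once.
  record Nesting : Set where
    field
      pts-injective : ∀ i → Injective _≡_ _≡_ (pts i)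
      pairs-twice   : ∀ {x y} → x ≢ y → TwoSolutions (λ i → In x i × In y i)
      avoids        : ∀ {i x} → In x i → ψ i ≢ inj₁ x
      inner-once    : ∀ {i j x y} → In x i → ψ i ≡ inj₁ y →
                      In x j × ψ j ≡ inj₁ y ⊎ In y j × ψ j ≡ inj₁ x → i ≡ j
      outer-once    : ∀ {i j o k} → ψ i ≡ inj₂ o → ψ j ≡ inj₂ o →
                      pts i k ≡ pts j k → i ≡ j

  module Realise {p o b : ℕ} (P↔ : P ↔ Fin p) (O↔ : O ↔ Fin o) (I↔ : I ↔ Fin b)
                 (N : Nesting) where

    open Nesting N
    open Inverse

    enc : P ⊎ O → Fin (p + o)
    enc = join p o ∘ Sum.map (to P↔) (to O↔)

    dec : Fin (p + o) → P ⊎ O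
    dec = Sum.map (from P↔) (from O↔) ∘ splitAt p

    enc-dec : ∀ x → enc (dec x) ≡ x
    enc-dec x with splitAt p x in eq
    ... | inj₁ a = trans (cong (join p o ∘ inj₁) (strictlyInverseˡ P↔ a))
                         (trans (cong (join p o) (sym eq)) (join-splitAt p o x))
    ... | inj₂ a = trans (cong (join p o ∘ inj₂) (strictlyInverseˡ O↔ a))
                         (trans (cong (join p o) (sym eq)) (join-splitAt p o x))

    map-injective : Injective _≡_ _≡_ (Sum.map (to P↔) (to O↔))
    map-injective {inj₁ a} {inj₁ b} eq = cong inj₁ (↔-injective P↔ (inj₁-injective eq))
    map-injective {inj₂ a} {inj₂ b} eq = cong inj₂ (↔-injective O↔ (inj₂-injective eq))

    enc-injective : Injective _≡_ _≡_ enc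
    enc-injective = map-injective ∘ ↔-injective (↔-sym (+↔⊎ {p} {o}))

    ι : P → Fin (p + o)
    ι = enc ∘ inj₁

    ι-injective : Injective _≡_ _≡_ ι
    ι-injective = inj₁-injective ∘ enc-injective

    idx : Fin b → I
    idx = from I↔

    block : I → Subset (p + o)
    block i = (⁅ ι (pts i 0F) ⁆ ∪ ⁅ ι (pts i 1F) ⁆) ∪ ⁅ ι (pts i 2F) ⁆

    𝒜 : Blocks (p + o) b
    𝒜 = block ∘ idx

    φ : Fin b → Fin (p + o)
    φ = enc ∘ ψ ∘ idx

    X : Subset (p + o)
    X = initial p o

    ι∈X : ∀ x → ι x ∈ X
    ι∈X x = ↑ˡ∈initial (to P↔ x) o

    ∈X⇒ι : ∀ {x} → x ∈ X → ∃[ a ] x ≡ ι a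
    ∈X⇒ι x∈ with i , refl ← ∈initial⇒↑ˡ p x∈ =
      from P↔ i , cong (_↑ˡ o) (sym (strictlyInverseˡ P↔ i))

    ∈block⁺ : ∀ {x i} → In x i → ι x ∈ block i
    ∈block⁺ (0F , refl) = x∈p∪q⁺ (inj₁ (x∈p∪q⁺ (inj₁ (x∈⁅x⁆ _))))
    ∈block⁺ (1F , refl) = x∈p∪q⁺ (inj₁ (x∈p∪q⁺ (inj₂ (x∈⁅x⁆ _))))
    ∈block⁺ (2F , refl) = x∈p∪q⁺ (inj₂ (x∈⁅x⁆ _))

    ∈block⁻ : ∀ {x} i → x ∈ block i → ∃[ k ] x ≡ ι (pts i k)
    ∈block⁻ i x∈ with x∈p∪q⁻ _ _ x∈
    ... | inj₂ x∈₂ = 2F , x∈⁅y⁆⇒x≡y _ x∈₂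
    ... | inj₁ x∈′ with x∈p∪q⁻ _ _ x∈′
    ...   | inj₁ x∈₀ = 0F , x∈⁅y⁆⇒x≡y _ x∈₀
    ...   | inj₂ x∈₁ = 1F , x∈⁅y⁆⇒x≡y _ x∈₁

    ι∈block⁻ : ∀ {x i} → ι x ∈ block i → In x i
    ι∈block⁻ {i = i} x∈ with k , eq ← ∈block⁻ i x∈ = k , sym (ι-injective eq)

    block⊆X : ∀ i → block i ⊆ X
    block⊆X i x∈ with k , refl ← ∈block⁻ i x∈ = ι∈X _

    ∣block∣ : ∀ i → ∣ block i ∣ ≡ 3
    ∣block∣ i = begin
      ∣ block i ∣                                     ≡⟨ ∣p∪⁅x⁆∣ _ _ 2∉ ⟩
      suc ∣ ⁅ ι (pts i 0F) ⁆ ∪ ⁅ ι (pts i 1F) ⁆ ∣    ≡⟨ cong suc (∣p∪⁅x⁆∣ _ _ 1∉) ⟩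
      2 + ∣ ⁅ ι (pts i 0F) ⁆ ∣                        ≡⟨ cong (λ k → 2 + k) (∣⁅x⁆∣≡1 (ι (pts i 0F))) ⟩
      3                                               ∎
      where
      open ≡-Reasoning
      ∈⁅⁆ : ∀ {k l} → ι (pts i k) ∈ ⁅ ι (pts i l) ⁆ → k ≡ l
      ∈⁅⁆ x∈ = pts-injective i (ι-injective (x∈⁅y⁆⇒x≡y _ x∈))
      1∉ : ι (pts i 1F) ∉ ⁅ ι (pts i 0F) ⁆
      1∉ x∈ with () ← ∈⁅⁆ x∈
      2∉ : ι (pts i 2F) ∉ ⁅ ι (pts i 0F) ⁆ ∪ ⁅ ι (pts i 1F) ⁆
      2∉ x∈ with x∈p∪q⁻ _ _ x∈
      ... | inj₁ x∈₀ with () ← ∈⁅⁆ x∈₀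
      ... | inj₂ x∈₁ with () ← ∈⁅⁆ x∈₁

    φ∉block : ∀ i → φ i ∉ 𝒜 i
    φ∉block i φ∈ with k , eq ← ∈block⁻ (idx i) φ∈ = avoids (k , refl) (enc-injective eq)

    module _ {x y : P} (x≢y : x ≢ y) where
      open TwoSolutions (pairs-twice x≢y)

      private
        Both : Fin b → Set
        Both i = ι x ∈ 𝒜 i × ι y ∈ 𝒜 i

        which : ∀ {i} → idx i ≡ i₀ ⊎ idx i ≡ i₁ → Fin 2
        which = [ (λ _ → 0F) , (λ _ → 1F) ]′

        which-injective : ∀ {i j} (s : idx i ≡ i₀ ⊎ idx i ≡ i₁)
                          (t : idx j ≡ i₀ ⊎ idx j ≡ i₁) → which s ≡ which t → i ≡ j
        which-injective (inj₁ s) (inj₁ t) _ = ↔-injective (↔-sym I↔) (trans s (sym t))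
        which-injective (inj₂ s) (inj₂ t) _ = ↔-injective (↔-sym I↔) (trans s (sym t))

        split : ∀ {i} → Both i → idx i ≡ i₀ ⊎ idx i ≡ i₁
        split (x∈ , y∈) = complete (ι∈block⁻ x∈ , ι∈block⁻ y∈)

        sol : Fin 2 → I
        sol 0F = i₀
        sol 1F = i₁

        sol-injective : Injective _≡_ _≡_ sol
        sol-injective {0F} {0F} _  = refl
        sol-injective {0F} {1F} eq = contradiction eq i₀≢i₁
        sol-injective {1F} {0F} eq = contradiction (sym eq) i₀≢i₁
        sol-injective {1F} {1F} _  = refl

        both : ∀ c → Both (to I↔ (sol c))
        both c rewrite strictlyInverseʳ I↔ (sol c) with c
        ... | 0F = ∈block⁺ (proj₁ P₀) , ∈block⁺ (proj₂ P₀)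
        ... | 1F = ∈block⁺ (proj₁ P₁) , ∈block⁺ (proj₂ P₁)

        -- A block of the nesting through x and y either is one of the two
        -- original blocks through them, or owes the pair to its new point.
        Origin : I → Set
        Origin i = (i ≡ i₀ ⊎ i ≡ i₁) ⊎ (In x i × ψ i ≡ inj₁ y ⊎ In y i × ψ i ≡ inj₁ x)

        origin : ∀ {i} → ι x ∈ nest 𝒜 φ i × ι y ∈ nest 𝒜 φ i → Origin (idx i)
        origin (x∈ , y∈) with x∈p∪q⁻ _ _ x∈ | x∈p∪q⁻ _ _ y∈
        ... | inj₁ x∈A | inj₁ y∈A = inj₁ (split (x∈A , y∈A))
        ... | inj₁ x∈A | inj₂ y∈φ =
          inj₂ (inj₁ (ι∈block⁻ x∈A , sym (enc-injective (x∈⁅y⁆⇒x≡y _ y∈φ))))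
        ... | inj₂ x∈φ | inj₁ y∈A =
          inj₂ (inj₂ (ι∈block⁻ y∈A , sym (enc-injective (x∈⁅y⁆⇒x≡y _ x∈φ))))
        ... | inj₂ x∈φ | inj₂ y∈φ =
          contradiction (ι-injective (trans (x∈⁅y⁆⇒x≡y _ x∈φ) (sym (x∈⁅y⁆⇒x≡y _ y∈φ)))) x≢y

        -- The values `0F` and `1F` stand for the two original blocks, `2F` for the only block that
        -- can create the pair.
        rank : ∀ {i} → Origin i → Fin 3
        rank (inj₁ (inj₁ _)) = 0F
        rank (inj₁ (inj₂ _)) = 1F
        rank (inj₂ _)        = 2F

        rank-injective : ∀ {i j} (s : Origin i) (t : Origin j) → rank s ≡ rank t → i ≡ j
        rank-injective (inj₁ (inj₁ s)) (inj₁ (inj₁ t)) _ = trans s (sym t)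
        rank-injective (inj₁ (inj₂ s)) (inj₁ (inj₂ t)) _ = trans s (sym t)
        rank-injective (inj₁ (inj₁ _)) (inj₁ (inj₂ _)) ()
        rank-injective (inj₁ (inj₂ _)) (inj₁ (inj₁ _)) ()
        rank-injective (inj₁ (inj₁ _)) (inj₂ _) ()
        rank-injective (inj₁ (inj₂ _)) (inj₂ _) ()
        rank-injective (inj₂ _) (inj₁ (inj₁ _)) ()
        rank-injective (inj₂ _) (inj₁ (inj₂ _)) ()
        rank-injective (inj₂ (inj₁ (x∈ , eq))) (inj₂ t) _ = inner-once x∈ eq t
        rank-injective (inj₂ (inj₂ (y∈ , eq))) (inj₂ t) _ = inner-once y∈ eq (Sum.swap t)

      pairCount≡2 : pairCount 𝒜 (ι x) (ι y) ≡ 2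
      pairCount≡2 = ≤-antisym
        (count≤ _ (which ∘ split) λ p q → which-injective (split p) (split q))
        (count≥ _ (to I↔ ∘ sol) (sol-injective ∘ ↔-injective I↔) both)

      inner-pairCount≤3 : pairCount (nest 𝒜 φ) (ι x) (ι y) ≤ 3
      inner-pairCount≤3 = count≤ _ (rank ∘ origin) λ p q eq →
        ↔-injective (↔-sym I↔) (rank-injective (origin p) (origin q) eq)

    module _ {o′ : O} {y : Fin (p + o)} (o≢y : enc (inj₂ o′) ≢ y) where

      private
        Outer : Fin b → Set
        Outer i = ψ (idx i) ≡ inj₂ o′ × (∃[ k ] y ≡ ι (pts (idx i) k))

        -- A new point lies in no original block, so it must be the nesting point, and a block has
        -- only one of these. The other point then sits at one of three positions of the original
        -- block, and that position tells the counted blocks apart.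
        outer : ∀ {i} → enc (inj₂ o′) ∈ nest 𝒜 φ i × y ∈ nest 𝒜 φ i → Outer i
        outer (o∈ , y∈) with x∈p∪q⁻ _ _ o∈ | x∈p∪q⁻ _ _ y∈
        ... | inj₁ o∈A | _ with _ , eq ← ∈block⁻ _ o∈A with () ← enc-injective {inj₂ _} {inj₁ _} eq
        outer _ | inj₂ o∈φ | inj₁ y∈A = sym (enc-injective (x∈⁅y⁆⇒x≡y _ o∈φ)) , ∈block⁻ _ y∈A
        outer _ | inj₂ o∈φ | inj₂ y∈φ =
          contradiction (trans (x∈⁅y⁆⇒x≡y _ o∈φ) (sym (x∈⁅y⁆⇒x≡y _ y∈φ))) o≢y

        outer-injective : ∀ {i j} (s : Outer i) (t : Outer j) →
                          proj₁ (proj₂ s) ≡ proj₁ (proj₂ t) → i ≡ j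
        outer-injective (s , _ , eq) (t , _ , eq′) refl = ↔-injective (↔-sym I↔)
          (outer-once s t (ι-injective (trans (sym eq) eq′)))

      outer-pairCount≤3 : pairCount (nest 𝒜 φ) (enc (inj₂ o′)) y ≤ 3 ×
                          pairCount (nest 𝒜 φ) y (enc (inj₂ o′)) ≤ 3
      outer-pairCount≤3 =
        count≤ _ (proj₁ ∘ proj₂ ∘ outer) (λ s t → outer-injective (outer s) (outer t)) ,
        count≤ _ (proj₁ ∘ proj₂ ∘ outer ∘ swap)
          (λ s t → outer-injective (outer (swap s)) (outer (swap t)))

    nested-pairCount≤3 : ∀ {x y} → x ≢ y → pairCount (nest 𝒜 φ) x y ≤ 3
    -- `enc` reaches every ambient point, so both points may be taken as encodings and sorted into
    -- old and new.
    nested-pairCount≤3 {x} {y} = subst₂ (λ x y → x ≢ y → pairCount (nest 𝒜 φ) x y ≤ 3)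
                                   (enc-dec x) (enc-dec y) (go (dec x) (dec y))
      where
      go : ∀ x y → enc x ≢ enc y → pairCount (nest 𝒜 φ) (enc x) (enc y) ≤ 3
      go (inj₁ _) (inj₁ _) ne = inner-pairCount≤3 (ne ∘ cong ι)
      go (inj₂ _) _        ne = proj₁ (outer-pairCount≤3 ne)
      go (inj₁ _) (inj₂ _) ne = proj₂ (outer-pairCount≤3 (ne ∘ sym))

    isWeakNesting : IsWeakNesting p (p + o) 3 2 X ⊤ 𝒜 φ
    isWeakNesting = record
      { bibd = record
        { order     = ∣initial∣ p o
        ; block⊆X   = λ i → block⊆X (idx i)
        ; blockSize = λ i → ∣block∣ (idx i)
        ; pairs     = pairs
        }
      ; X⊆Y     = λ _ → ∈⊤
      ; ∣Y∣≡w   = ∣⊤∣≡n (p + o)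
      ; φ∈Y     = λ _ → ∈⊤
      ; φ∉block = φ∉block
      ; partial = record
        { order     = ∣⊤∣≡n (p + o)
        ; block⊆X   = λ _ _ → ∈⊤
        ; blockSize = λ i → trans (∣p∪⁅x⁆∣ (𝒜 i) (φ i) (φ∉block i)) (cong suc (∣block∣ (idx i)))
        ; pairs     = λ _ _ → nested-pairCount≤3
        }
      }
      where
      pairs : ∀ {x y} → x ∈ X → y ∈ X → x ≢ y → pairCount 𝒜 x y ≡ 2
      pairs x∈ y∈ x≢y with a , refl ← ∈X⇒ι x∈ | b , refl ← ∈X⇒ι y∈ = pairCount≡2 (x≢y ∘ cong ι)

-- The cyclic order of the three rows.

next : Fin 3 → Fin 3
next 0F = 1F
next 1F = 2F
next 2F = 0F

next³ : ∀ r → next (next (next r)) ≡ r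
next³ 0F = refl
next³ 1F = refl
next³ 2F = refl

next≢ : ∀ {r} → next r ≢ r
next≢ {0F} ()
next≢ {1F} ()
next≢ {2F} ()

next²≢ : ∀ {r} → next (next r) ≢ r
next²≢ {0F} ()
next²≢ {1F} ()
next²≢ {2F} ()

next-injective : Injective _≡_ _≡_ next
next-injective {r} {s} eq = trans (sym (next³ r)) (trans (cong (next ∘ next) eq) (next³ s))

-- With only three rows, two different rows are always cyclic neighbours.
data Rows : Fin 3 → Fin 3 → Set where
  same  : ∀ r → Rows r r
  above : ∀ r → Rows r (next r)
  below : ∀ r → Rows (next r) r

rows : ∀ r s → Rows r s
rows 0F 0F = same 0F
rows 0F 1F = above 0F
rows 0F 2F = below 2F
rows 1F 0F = below 0F
rows 1F 1F = same 1F
rows 1F 2F = above 1F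
rows 2F 0F = above 2F
rows 2F 1F = below 1F
rows 2F 2F = same 2F

-- Columns as an abstract group with translations.

-- The labels of the differences between adjacent rows that the nesting creates.
data Mixed (S : Set) : Set where
  lower upper : S → Mixed S
  up⁺ up⁻     : Mixed S

-- G is the cyclic group of columns and E its set of nonzero elements: lo e and hi e
-- translate by −e and e, and up translates by u.  The class e is nested within X by
-- the shift s if κ e = inj₁ s (then e = ε s), and by the new point o if κ e = inj₂ o.
record Moves (G E S O : Set) : Set where
  field
    eq? : DecidableEquality G
    lo hi : E → G → G
    neg   : E → E
    sh    : S → G → G
    up    : G → G
    κ     : E → S ⊎ O
    ε     : S → E

  base tip : Mixed S → G → G
  base (lower s) g = lo (ε s) g
  base (upper s) g = hi (ε s) g
  base up⁺       g = g
  -- The nesting point lies in row r + 2, cyclically just below row r, so it is the base of its pair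
  -- with (g, r).
  base up⁻       g = up g
  tip (lower s) g = sh s g
  tip (upper s) g = sh s g
  tip up⁺       g = up g
  tip up⁻       g = g

-- This interface keeps modular arithmetic out of the block construction. `mid` and `mid-unique`
-- amount to division by 2, `sh∘sh≢` to no two shifts summing to zero, and `mixed-unique` to the
-- differences of tip and base being distinct.
record Columns (G E S O : Set) : Set where
  field
    moves : Moves G E S O

  open Moves moves public

  field
    lo-neg    : ∀ e g → lo (neg e) g ≡ hi e g
    hi-neg    : ∀ e g → hi (neg e) g ≡ lo e g
    neg≢      : ∀ e → neg e ≢ e
    lo≢       : ∀ {e g} → lo e g ≢ g
    lo-injᵍ   : ∀ {e g g′} → lo e g ≡ lo e g′ → g ≡ g′
    lo-injᵉ   : ∀ {e e′ g} → lo e g ≡ lo e′ g → e ≡ e′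
    diff      : ∀ {a b} → a ≢ b → ∃[ e ] lo e b ≡ a
    mid       : ∀ {a b} → a ≢ b → ∃[ e ] ∃[ g ] lo e g ≡ a × hi e g ≡ b
    mid-unique : ∀ {e e′ g g′} → lo e g ≡ lo e′ g′ → hi e g ≡ hi e′ g′ → e ≡ e′ × g ≡ g′

    κ-injective : Injective _≡_ _≡_ κ
    κ⇒ε         : ∀ {e s} → κ e ≡ inj₁ s → e ≡ ε s
    sh≢         : ∀ {s g} → sh s g ≢ g
    sh-injective : ∀ {s s′ g} → sh s g ≡ sh s′ g → s ≡ s′
    sh∘sh≢      : ∀ {s s′ g} → sh s (sh s′ g) ≢ g
    up-injective : Injective _≡_ _≡_ up
    mixed-unique : ∀ d d′ {g g′} → base d g ≡ base d′ g′ → tip d g ≡ tip d′ g′ → d ≡ d′ × g ≡ g′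

-- The blocks, their nesting and its verification.

module Construction {G E S O : Set} (C : Columns G E S O) where

  open Columns C

  hi≢ : ∀ {e g} → hi e g ≢ g
  hi≢ {e} {g} eq = lo≢ (trans (lo-neg e g) eq)

  hi-injᵍ : ∀ {e g g′} → hi e g ≡ hi e g′ → g ≡ g′
  hi-injᵍ {e} {g} {g′} eq = lo-injᵍ (trans (lo-neg e g) (trans eq (sym (lo-neg e g′))))

  hi-injᵉ : ∀ {e e′ g} → hi e g ≡ hi e′ g → e ≡ e′
  hi-injᵉ {e} {e′} {g} eq = proj₁ (mid-unique lo≡ eq)
    where
    lo≡ : lo e g ≡ lo e′ g
    lo≡ = begin
      lo e g                ≡⟨ hi-neg e g ⟨
      hi (neg e) g          ≡⟨ cong (λ e → hi e g) (lo-injᵉ neg≡) ⟩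
      hi (neg e′) g         ≡⟨ hi-neg e′ g ⟩
      lo e′ g               ∎
      where
      open ≡-Reasoning
      neg≡ : lo (neg e) g ≡ lo (neg e′) g
      neg≡ = trans (lo-neg e g) (trans eq (sym (lo-neg e′ g)))

  lo≢hi : ∀ {e g} → lo e g ≢ hi e g
  lo≢hi {e} {g} eq = neg≢ e (lo-injᵉ (trans (lo-neg e g) (sym eq)))

  Point Index : Set
  Point = Unit ⊎ (G × Fin 3)
  Index = (G × Fin 3 × E) ⊎ ((G × Fin 3) ⊎ G)

  pattern ∞        = inj₁ tt
  pattern pt a r   = inj₂ (a , r)
  pattern tri g r e = inj₁ (g , r , e)
  pattern inf g r  = inj₂ (inj₁ (g , r))
  pattern col g    = inj₂ (inj₂ g)

  pts : Index → Fin 3 → Point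
  pts (tri g r e) 0F = pt (lo e g) r
  pts (tri g r e) 1F = pt (hi e g) r
  pts (tri g r e) 2F = pt g (next r)
  pts (inf g r)   0F = ∞
  pts (inf g r)   1F = pt g r
  pts (inf g r)   2F = pt g (next r)
  pts (col g)     k  = pt g k

  -- A new point in `O` serves all triangles of its class, over every column and row; the `Unit`
  -- point serves the blocks `col g`.
  ψ : Index → Point ⊎ (O ⊎ Unit)
  ψ (tri g r e) = Sum.map (λ s → pt (sh s g) (next r)) inj₁ (κ e)
  ψ (inf g r)   = inj₁ (pt (up g) (next (next r)))
  ψ (col g)     = inj₂ (inj₂ tt)

  open Labelled pts ψ

  column : ∀ {a b : G} {r s : Fin 3} → _≡_ {A = Point} (pt a r) (pt b s) → a ≡ b
  column refl = refl

  row : ∀ {a b : G} {r s : Fin 3} → _≡_ {A = Point} (pt a r) (pt b s) → r ≡ s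
  row refl = refl

  pts-injective : ∀ i → Injective _≡_ _≡_ (pts i)
  pts-injective (tri g r e) {0F} {0F} _  = refl
  pts-injective (tri g r e) {0F} {1F} eq = contradiction (column eq) lo≢hi
  pts-injective (tri g r e) {0F} {2F} eq = contradiction (column eq) lo≢
  pts-injective (tri g r e) {1F} {0F} eq = contradiction (sym (column eq)) lo≢hi
  pts-injective (tri g r e) {1F} {1F} _  = refl
  pts-injective (tri g r e) {1F} {2F} eq = contradiction (column eq) hi≢
  pts-injective (tri g r e) {2F} {0F} eq = contradiction (sym (column eq)) lo≢
  pts-injective (tri g r e) {2F} {1F} eq = contradiction (sym (column eq)) hi≢
  pts-injective (tri g r e) {2F} {2F} _  = refl
  pts-injective (inf g r)   {0F} {0F} _  = refl
  pts-injective (inf g r)   {0F} {1F} ()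
  pts-injective (inf g r)   {0F} {2F} ()
  pts-injective (inf g r)   {1F} {0F} ()
  pts-injective (inf g r)   {2F} {0F} ()
  pts-injective (inf g r)   {1F} {1F} _  = refl
  pts-injective (inf g r)   {1F} {2F} eq = contradiction (sym (row eq)) next≢
  pts-injective (inf g r)   {2F} {1F} eq = contradiction (row eq) next≢
  pts-injective (inf g r)   {2F} {2F} _  = refl
  pts-injective (col g)     eq           = row eq

  Through : Point → Point → Index → Set
  Through x y i = In x i × In y i

  through-∞ : ∀ a r → TwoSolutions (Through ∞ (pt a r))
  -- `next (next r)` is the row before `r`, whose block through `∞` has (a, r) as last point.
  through-∞ a r = two {i₀ = inf a r} {inf a (next (next r))}
    (λ where eq → next²≢ (sym (infRow eq)))
    ((0F , refl) , (1F , refl))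
    ((0F , refl) , (2F , cong (pt a) (next³ r)))
    complete
    where
    infRow : ∀ {s s′ : Fin 3} → _≡_ {A = Index} (inf a s) (inf a s′) → s ≡ s′
    infRow refl = refl
    complete : ∀ {i} → Through ∞ (pt a r) i → i ≡ inf a r ⊎ i ≡ inf a (next (next r))
    complete {tri _ _ _} ((0F , ()) , _)
    complete {tri _ _ _} ((1F , ()) , _)
    complete {tri _ _ _} ((2F , ()) , _)
    complete {inf _ _} (_ , (1F , refl)) = inj₁ refl
    complete {inf g s} (_ , (2F , refl)) = inj₂ (cong (λ s → inf g s) (sym (next³ s)))

  -- The apex column is the midpoint of `a` and `b`, and `e` is half their difference up to sign.
  -- The two signs give the same three points with `lo` and `hi` exchanged: a repeated block whose
  -- two indices are nested separately.
  through-row : ∀ {a b} r → a ≢ b → TwoSolutions (Through (pt a r) (pt b r))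
  through-row {a} {b} r a≢b with e , g , lo≡ , hi≡ ← mid a≢b =
    two {i₀ = tri g r e} {tri g r (neg e)}
      (λ eq → neg≢ e (sym (class eq)))
      ((0F , cong (λ a → pt a r) lo≡) , (1F , cong (λ a → pt a r) hi≡))
      ((1F , cong (λ a → pt a r) (trans (hi-neg e g) lo≡)) ,
       (0F , cong (λ a → pt a r) (trans (lo-neg e g) hi≡)))
      complete
    where
    class : ∀ {e e′ : E} → _≡_ {A = Index} (tri g r e) (tri g r e′) → e ≡ e′
    class refl = refl
    complete : ∀ {i} → Through (pt a r) (pt b r) i → i ≡ tri g r e ⊎ i ≡ tri g r (neg e)
    complete {tri h _ f} ((0F , refl) , (0F , refl)) = contradiction refl a≢b
    complete {tri h _ f} ((0F , refl) , (1F , refl))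
      with refl , refl ← mid-unique lo≡ hi≡ = inj₁ refl
    complete {tri h _ f} ((0F , refl) , (2F , eq))   = contradiction (row eq) next≢
    complete {tri h _ f} ((1F , refl) , (0F , refl))
      with refl , refl ← mid-unique (trans (lo-neg e g) hi≡) (trans (hi-neg e g) lo≡) = inj₂ refl
    complete {tri h _ f} ((1F , refl) , (1F , refl)) = contradiction refl a≢b
    complete {tri h _ f} ((1F , refl) , (2F , eq))   = contradiction (row eq) next≢
    complete {tri h _ f} ((2F , refl) , (0F , eq))   = contradiction (sym (row eq)) next≢
    complete {tri h _ f} ((2F , refl) , (1F , eq))   = contradiction (sym (row eq)) next≢
    complete {tri h _ f} ((2F , refl) , (2F , refl)) = contradiction refl a≢b
    complete {inf h _} ((1F , refl) , (1F , refl)) = contradiction refl a≢b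
    complete {inf h _} ((1F , refl) , (2F , eq))   = contradiction (row eq) next≢
    complete {inf h _} ((2F , refl) , (1F , eq))   = contradiction (sym (row eq)) next≢
    complete {inf h _} ((2F , refl) , (2F , refl)) = contradiction refl a≢b
    complete {col h} ((_ , refl) , (_ , refl)) = contradiction refl a≢b

  -- The point in row r + 1 must be the apex: a triangle with apex in row r has its other points in
  -- row r - 1, which is not r + 1. So the apex column is `b`, and `e` is b - a up to sign.
  through-rows : ∀ {a b} r → a ≢ b → TwoSolutions (Through (pt a r) (pt b (next r)))
  through-rows {a} {b} r a≢b with e , lo≡ ← diff a≢b =
    two {i₀ = tri b r e} {tri b r (neg e)}
      (λ eq → neg≢ e (sym (class eq)))
      ((0F , cong (λ a → pt a r) lo≡) , (2F , refl))
      ((1F , cong (λ a → pt a r) (trans (hi-neg e b) lo≡)) , (2F , refl))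
      complete
    where
    class : ∀ {e e′ : E} → _≡_ {A = Index} (tri b r e) (tri b r e′) → e ≡ e′
    class refl = refl
    complete : ∀ {i} → Through (pt a r) (pt b (next r)) i → i ≡ tri b r e ⊎ i ≡ tri b r (neg e)
    complete {tri h _ f} ((0F , refl) , (0F , eq))   = contradiction (sym (row eq)) next≢
    complete {tri h _ f} ((0F , refl) , (1F , eq))   = contradiction (sym (row eq)) next≢
    complete {tri h s f} ((0F , refl) , (2F , refl)) = inj₁ (cong (λ f → tri h s f) (lo-injᵉ (sym lo≡)))
    complete {tri h _ f} ((1F , refl) , (0F , eq))   = contradiction (sym (row eq)) next≢
    complete {tri h _ f} ((1F , refl) , (1F , eq))   = contradiction (sym (row eq)) next≢
    complete {tri h s f} ((1F , refl) , (2F , refl)) =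
      inj₂ (cong (λ f → tri h s f) (hi-injᵉ (sym (trans (hi-neg e h) lo≡))))
    complete {tri h _ f} ((2F , refl) , (0F , eq))   = contradiction (sym (row eq)) next²≢
    complete {tri h _ f} ((2F , refl) , (1F , eq))   = contradiction (sym (row eq)) next²≢
    complete {tri h _ f} ((2F , refl) , (2F , eq))   = contradiction (sym (row eq)) next≢
    complete {inf h _} ((1F , refl) , (1F , eq))   = contradiction (sym (row eq)) next≢
    complete {inf h _} ((1F , refl) , (2F , refl)) = contradiction refl a≢b
    complete {inf h _} ((2F , refl) , (1F , eq))   = contradiction (sym (row eq)) next²≢
    complete {inf h _} ((2F , refl) , (2F , eq))   = contradiction (sym (row eq)) next≢
    complete {col h} ((_ , refl) , (_ , refl)) = contradiction refl a≢b

  -- A triangle never meets a column twice, since `e` is nonzero, so only the vertical blocks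
  -- remain.
  through-column : ∀ a r → TwoSolutions (Through (pt a r) (pt a (next r)))
  through-column a r = two {i₀ = inf a r} {col a} (λ ())
    ((1F , refl) , (2F , refl)) ((r , refl) , (next r , refl)) complete
    where
    complete : ∀ {i} → Through (pt a r) (pt a (next r)) i → i ≡ inf a r ⊎ i ≡ col a
    complete {tri h _ f} ((0F , refl) , (0F , eq)) = contradiction (sym (row eq)) next≢
    complete {tri h _ f} ((0F , refl) , (1F , eq)) = contradiction (sym (row eq)) next≢
    complete {tri h _ f} ((0F , refl) , (2F , eq)) = contradiction (sym (column eq)) lo≢
    complete {tri h _ f} ((1F , refl) , (0F , eq)) = contradiction (sym (row eq)) next≢
    complete {tri h _ f} ((1F , refl) , (1F , eq)) = contradiction (sym (row eq)) next≢
    complete {tri h _ f} ((1F , refl) , (2F , eq)) = contradiction (sym (column eq)) hi≢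
    complete {tri h _ f} ((2F , refl) , (0F , eq)) = contradiction (sym (row eq)) next²≢
    complete {tri h _ f} ((2F , refl) , (1F , eq)) = contradiction (sym (row eq)) next²≢
    complete {tri h _ f} ((2F , refl) , (2F , eq)) = contradiction (sym (row eq)) next≢
    complete {inf h _} ((1F , refl) , (1F , eq))   = contradiction (sym (row eq)) next≢
    complete {inf h _} ((1F , refl) , (2F , refl)) = inj₁ refl
    complete {inf h _} ((2F , refl) , (1F , eq))   = contradiction (sym (row eq)) next²≢
    complete {inf h _} ((2F , refl) , (2F , eq))   = contradiction (sym (row eq)) next≢
    complete {col h} ((_ , refl) , _) = inj₂ refl

  through-above : ∀ a b r → TwoSolutions (Through (pt a r) (pt b (next r)))
  through-above a b r with eq? a b
  ... | yes refl = through-column a r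
  ... | no  a≢b  = through-rows r a≢b

  pairs-twice : ∀ {x y} → x ≢ y → TwoSolutions (Through x y)
  pairs-twice {∞}      {∞}      x≢y = contradiction refl x≢y
  pairs-twice {∞}      {pt a r} x≢y = through-∞ a r
  pairs-twice {pt a r} {∞}      x≢y = two-map swap swap (through-∞ a r)
  pairs-twice {pt a r} {pt b s} x≢y with rows r s
  ... | same r  = through-row r (x≢y ∘ cong (λ a → pt a r))
  ... | above r = through-above a b r
  ... | below s = two-map swap swap (through-above b a s)

  -- Here `r` is the row of the base. In the block `inf g s` the base is in row s + 1 for `up⁺`, and
  -- for `up⁻` it is the nesting point in row s + 2, so s is r - 1 or r - 2 modulo 3.
  blk : Mixed S → G → Fin 3 → Index
  blk (lower s) g r = tri g r (ε s)
  blk (upper s) g r = tri g r (ε s)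
  blk up⁺       g r = inf g (next (next r))
  blk up⁻       g r = inf g (next r)

  -- The pairs {x , y} that the nesting of the block i creates; a pair of points in
  -- adjacent rows is listed with its lower point first.
  data New : Index → Point → Point → Set where
    mixed : ∀ d g r → New (blk d g r) (pt (base d g) r) (pt (tip d g) (next r))
    pure  : ∀ s g r → New (tri g r (ε s)) (pt g (next r)) (pt (sh s g) (next r))
    cusp  : ∀ g r → New (inf g r) ∞ (pt (up g) (next (next r)))

  new : ∀ i {x y} → In x i → ψ i ≡ inj₁ y → New i x y ⊎ New i y x
  new (tri g r e) (k , eq) ψ≡ with κ e in κ≡
  new (tri g r e) (k , eq) () | inj₂ _
  new (tri g r e) (k , eq) ψ≡ | inj₁ s with refl ← κ⇒ε κ≡ | k | eq | ψ≡
  ... | 0F | refl | refl = inj₁ (mixed (lower s) g r)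
  ... | 1F | refl | refl = inj₁ (mixed (upper s) g r)
  ... | 2F | refl | refl = inj₁ (pure s g r)
  new (inf g r) (0F , refl) refl = inj₁ (cusp g r)
  new (inf g r) (1F , refl) refl = inj₂
    (subst (λ s → New (inf g s) (pt (up g) (next (next r))) (pt g s)) (next³ r)
      (mixed up⁻ g (next (next r))))
  new (inf g r) (2F , refl) refl = inj₁
    (subst (λ s → New (inf g s) (pt g (next r)) (pt (up g) (next (next r)))) (next³ r)
      (mixed up⁺ g (next r)))

  -- The presence of `∞` and the agreement of the rows separate the three kinds of pair. Within a
  -- kind, the columns recover the block.
  new-unique : ∀ {i j x y x′ y′} → New i x y → New j x′ y′ → x ≡ x′ → y ≡ y′ → i ≡ j
  new-unique (mixed d g r) (mixed d′ g′ r′) x≡ y≡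
    with refl , refl ← mixed-unique d d′ (column x≡) (column y≡) = cong (blk d g) (row x≡)
  new-unique (mixed _ _ _) (pure _ _ _) x≡ y≡ =
    contradiction (trans (row y≡) (sym (row x≡))) next≢
  new-unique (pure _ _ _) (mixed _ _ _) x≡ y≡ =
    contradiction (trans (sym (row y≡)) (row x≡)) next≢
  new-unique (pure s g r) (pure s′ g′ r′) x≡ y≡
    with refl ← column x≡ | refl ← next-injective (row x≡)
    with refl ← sh-injective (column y≡) = refl
  new-unique (cusp g r) (cusp g′ r′) _ y≡
    with refl ← up-injective (column y≡) | refl ← next-injective (next-injective (row y≡)) = refl

  -- Read backwards, a mixed pair would need r + 2 to be r, and a pure pair two shifts summing to
  -- zero; `∞` always comes first.
  new-oriented : ∀ {i j x y x′ y′} → New i x y → New j x′ y′ → x ≡ y′ → ¬ y ≡ x′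
  new-oriented (mixed _ _ _) (mixed _ _ _) x≡ y≡ =
    next²≢ (trans (cong next (sym (row x≡))) (row y≡))
  new-oriented (mixed _ _ _) (pure _ _ _) x≡ y≡ = next≢ (trans (row y≡) (sym (row x≡)))
  new-oriented (pure _ _ _) (mixed _ _ _) x≡ y≡ = next≢ (trans (sym (row x≡)) (row y≡))
  new-oriented (pure s _ _) (pure _ _ _) x≡ y≡ =
    sh∘sh≢ (trans (cong (sh s) (sym (column x≡))) (column y≡))
  new-oriented (cusp _ _) (mixed _ _ _) ()
  new-oriented (cusp _ _) (pure _ _ _) ()
  new-oriented (cusp _ _) (cusp _ _) ()
  new-oriented (mixed _ _ _) (cusp _ _) _ ()
  new-oriented (pure _ _ _) (cusp _ _) _ ()

  inner-once : ∀ {i j x y} → In x i → ψ i ≡ inj₁ y →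
               In x j × ψ j ≡ inj₁ y ⊎ In y j × ψ j ≡ inj₁ x → i ≡ j
  inner-once {i} {j} {x} {y} x∈ ψ≡ other = go (new i x∈ ψ≡)
    ([ (λ (x∈ , eq) → new j x∈ eq) , (λ (y∈ , eq) → Sum.swap (new j y∈ eq)) ]′ other)
    where
    go : New i x y ⊎ New i y x → New j x y ⊎ New j y x → i ≡ j
    go (inj₁ p) (inj₁ q) = new-unique p q refl refl
    go (inj₂ p) (inj₂ q) = new-unique p q refl refl
    go (inj₁ p) (inj₂ q) = contradiction refl (new-oriented p q refl)
    go (inj₂ p) (inj₁ q) = contradiction refl (new-oriented p q refl)

  avoids : ∀ {i x} → In x i → ψ i ≢ inj₁ x
  avoids {tri g r e} (k , eq) ψ≡ with κ e | ψ≡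
  ... | inj₁ s | refl with k
  ...   | 0F = next≢ (sym (row eq))
  ...   | 1F = next≢ (sym (row eq))
  ...   | 2F = sh≢ (sym (column eq))
  avoids {inf g r} (1F , eq) refl = next²≢ (sym (row eq))
  avoids {inf g r} (2F , eq) refl = next≢ (sym (row eq))

  outer-class : ∀ {g r e o} → ψ (tri g r e) ≡ inj₂ o → ∃[ o′ ] o ≡ inj₁ o′ × κ e ≡ inj₂ o′
  outer-class {e = e} eq with κ e | eq
  ... | inj₂ o | refl = o , refl , refl

  -- A new point fixes the class `e`, and then each position of a triangle determines column and
  -- row. The point of the `col` blocks belongs to no triangle.
  outer-once : ∀ {i j o k} → ψ i ≡ inj₂ o → ψ j ≡ inj₂ o → pts i k ≡ pts j k → i ≡ j
  outer-once {tri g r e} {tri g′ r′ e′} {k = k} p q eq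
    with _ , refl , κ≡ ← outer-class {g} {r} {e} p | _ , refl , κ′≡ ← outer-class {g′} {r′} {e′} q
    with refl ← κ-injective (trans κ≡ (sym κ′≡)) = go k eq
    where
    go : ∀ k → pts (tri g r e) k ≡ pts (tri g′ r′ e) k → _≡_ {A = Index} (tri g r e) (tri g′ r′ e)
    go 0F eq = cong₂ (λ g r → tri g r e) (lo-injᵍ (column eq)) (row eq)
    go 1F eq = cong₂ (λ g r → tri g r e) (hi-injᵍ (column eq)) (row eq)
    go 2F eq = cong₂ (λ g r → tri g r e) (column eq) (next-injective (row eq))
  outer-once {tri g r e} {col _} p refl eq with () ← proj₁ (proj₂ (outer-class {g} {r} {e} p))
  outer-once {col _} {tri g r e} refl q eq with () ← proj₁ (proj₂ (outer-class {g} {r} {e} q))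
  outer-once {col _} {col _} _ _ eq = cong (λ g → col g) (column eq)

  nesting : Nesting
  nesting = record
    { pts-injective = pts-injective
    ; pairs-twice   = pairs-twice
    ; avoids        = avoids
    ; inner-once    = inner-once
    ; outer-once    = outer-once
    }

-- Congruences modulo m.

open +-*-Solver using (solve; con; _:=_; _:+_; _:*_; _:-_; :-_)

module Residue (m : ℕ) .{{_ : NonZero m}} where

  infix 4 _≈_
  -- A record rather than bare divisibility, because `a` and `b` cannot be inferred from `a - b`.
  record _≈_ (a b : ℤ) : Set where
    constructor modulo
    field divisible : + m ∣ a - b

  -- Turns a congruence into a ring identity: the difference in the goal is an explicit combination
  -- of those in the hypotheses, and `solve` checks it.
  linear₁ : ∀ c {x x′ z z′} → x ≈ x′ → z - z′ ≡ c ℤ.* (x - x′) → z ≈ z′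
  linear₁ c (modulo p) eq = modulo (subst (+ m ∣_) (sym eq) (∣n⇒∣m*n c p))

  linear₂ : ∀ c d {x x′ y y′ z z′} → x ≈ x′ → y ≈ y′ →
            z - z′ ≡ c ℤ.* (x - x′) ℤ.+ d ℤ.* (y - y′) → z ≈ z′
  linear₂ c d (modulo p) (modulo q) eq =
    modulo (subst (+ m ∣_) (sym eq) (∣m∣n⇒∣m+n (∣n⇒∣m*n c p) (∣n⇒∣m*n d q)))

  ≈-refl : ∀ {a} → a ≈ a
  ≈-refl {a} = modulo (divides (+ 0) (solve 1 (λ a → a :- a := con (+ 0)) refl a))

  ≈-reflexive : ∀ {a b} → a ≡ b → a ≈ b
  ≈-reflexive refl = ≈-refl

  ≈-sym : ∀ {a b} → a ≈ b → b ≈ a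
  ≈-sym {a} {b} p = linear₁ (- + 1) p
    (solve 2 (λ a b → b :- a := con (- + 1) :* (a :- b)) refl a b)

  ≈-trans : ∀ {a b c} → a ≈ b → b ≈ c → a ≈ c
  ≈-trans {a} {b} {c} p q = linear₂ (+ 1) (+ 1) p q
    (solve 3 (λ a b c → a :- c := con (+ 1) :* (a :- b) :+ con (+ 1) :* (b :- c)) refl a b c)

  ≈-* : ∀ c {a b} → a ≈ b → c ℤ.* a ≈ c ℤ.* b
  ≈-* c {a} {b} p = linear₁ c p
    (solve 3 (λ c a b → c :* a :- c :* b := c :* (a :- b)) refl c a b)

  private
    -- `y ∸ x` is a multiple of `m` below `m`, hence zero.
    ordered : ∀ {x y} → x ≤ y → y < m → + y ≈ + x → x ≡ y
    ordered {x} {y} x≤y y<m p = ≤-antisym x≤y (m∸n≡0⇒m≤n (zero-multiple m∣ (≤-<-trans (m∸n≤m y x) y<m)))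
      where
      m∣ : m ℕ.∣ y ∸ x
      m∣ = subst (λ z → m ℕ.∣ ℤ.∣ z ∣) (trans (m-n≡m⊖n y x) (⊖-≥ x≤y)) (∣⇒∣ᵤ (_≈_.divisible p))
      zero-multiple : ∀ {d} → m ℕ.∣ d → d < m → d ≡ 0
      zero-multiple {zero}  _   _   = refl
      zero-multiple {suc d} m∣d d<m = contradiction m∣d (ℕ.>⇒∤ d<m)

  ≈⇒≡ : ∀ {x y} → x < m → y < m → + x ≈ + y → x ≡ y
  ≈⇒≡ {x} {y} x<m y<m p with ≤-total x y
  ... | inj₁ x≤y = ordered x≤y y<m (≈-sym p)
  ... | inj₂ y≤x = sym (ordered y≤x x<m p)

  ≉0 : ∀ {x} → 0 < x → x < m → ¬ + x ≈ + 0
  ≉0 0<x x<m p with refl ← ≈⇒≡ x<m (≤-<-trans z≤n x<m) p = contradiction 0<x 1+n≰n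

  ⟦_⟧ : Fin m → ℤ
  ⟦ g ⟧ = + toℕ g

  opaque

    -- The least nonnegative residue, opaque so that only `⟦ρ⟧` is visible and division never
    -- unfolds.
    ρ : ℤ → Fin m
    ρ a = fromℕ< (n%ℕd<d a m)

    ⟦ρ⟧ : ∀ a → ⟦ ρ a ⟧ ≈ a
    ⟦ρ⟧ a = modulo (divides (- q) (begin
      ⟦ ρ a ⟧ - a                ≡⟨ cong (λ r → + r - a) (toℕ-fromℕ< (n%ℕd<d a m)) ⟩
      r - a                      ≡⟨ cong (λ a → r - a) (a≡a%ℕn+[a/ℕn]*n a m) ⟩
      r - (r ℤ.+ q ℤ.* + m)      ≡⟨ solve 3 (λ r q m → r :- (r :+ q :* m) := :- q :* m) refl r q (+ m) ⟩
      - q ℤ.* + m                ∎))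
      where
      open ≡-Reasoning
      q r : ℤ
      q = a /ℕ m
      r = + (a %ℕ m)

  ⟦⟧-injective : ∀ {g h} → ⟦ g ⟧ ≈ ⟦ h ⟧ → g ≡ h
  ⟦⟧-injective {g} {h} p = toℕ-injective (≈⇒≡ (toℕ<n g) (toℕ<n h) p)

  ≈⇒ρ≡ : ∀ {a b} → a ≈ b → ρ a ≡ ρ b
  ≈⇒ρ≡ {a} {b} p = ⟦⟧-injective (≈-trans (⟦ρ⟧ a) (≈-trans p (≈-sym (⟦ρ⟧ b))))

  ρ≡⇒≈ : ∀ {a b} → ρ a ≡ ρ b → a ≈ b
  ρ≡⇒≈ {a} {b} eq = ≈-trans (≈-sym (⟦ρ⟧ a)) (≈-trans (≈-reflexive (cong ⟦_⟧ eq)) (⟦ρ⟧ b))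

  ≈⇒ρ≡′ : ∀ {a g} → a ≈ ⟦ g ⟧ → ρ a ≡ g
  ≈⇒ρ≡′ {a} p = ⟦⟧-injective (≈-trans (⟦ρ⟧ a) p)

  ρ≡′⇒≈ : ∀ {a g} → ρ a ≡ g → a ≈ ⟦ g ⟧
  ρ≡′⇒≈ {a} refl = ≈-sym (⟦ρ⟧ a)

-- The columns as residues modulo 4t + 3.

module Cyclic (t : ℕ) where

  -- The 4t + 2 nonzero residues are split as in `E`: t consecutive triples and t + 2 further
  -- values.
  m′ m : ℕ
  m′ = t * 3 + (t + 2)
  m  = suc m′

  open Residue m

  T : ℤ
  T = + t

  m≡ : + m ≡ + 4 ℤ.* T ℤ.+ + 3
  m≡ = trans (cong +_ (lemma t)) (cong (ℤ._+ + 3) (pos-* 4 t))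
    where
    lemma : ∀ t → suc (t * 3 + (t + 2)) ≡ 4 * t + 3
    lemma = ℕ-solve-∀

  4T+3≈0 : + 4 ℤ.* T ℤ.+ + 3 ≈ + 0
  4T+3≈0 = modulo (subst (+ m ∣_) (trans m≡ (solve 1 (λ a → a := a :- con (+ 0)) refl _)) ∣-refl)

  opaque

    -- 2 (2t + 2) = m + 1, so ½ inverts 2 modulo m.
    ½ : ℤ
    ½ = + 2 ℤ.* T ℤ.+ + 2

    halve : ∀ {a b} → + 2 ℤ.* a ≈ + 2 ℤ.* b → a ≈ b
    halve {a} {b} p = linear₂ ½ (b - a) p 4T+3≈0 (solve 3 (λ T a b →
      a :- b := (con (+ 2) :* T :+ con (+ 2)) :* (con (+ 2) :* a :- con (+ 2) :* b)
                :+ (b :- a) :* ((con (+ 4) :* T :+ con (+ 3)) :- con (+ 0))) refl T a b)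

    2½≈ : ∀ a → + 2 ℤ.* (½ ℤ.* a) ≈ a
    2½≈ a = linear₁ a 4T+3≈0 (solve 2 (λ T a →
      con (+ 2) :* ((con (+ 2) :* T :+ con (+ 2)) :* a) :- a :=
      a :* ((con (+ 4) :* T :+ con (+ 3)) :- con (+ 0)))
      refl T a)

  -- `inj₁ (j , c)` stands for e = 3j + c + 1, and the last summand for e from 3t + 1 to 4t + 2. The
  -- cases c = 0 and c = 2 form `S`; c = 1 and the last summand form the 2t + 2 points of `O`.
  E S O : Set
  E = (Fin t × Fin 3) ⊎ Fin (t + 2)
  S = Fin t ⊎ Fin t
  O = Fin t ⊎ Fin (t + 2)

  E↔ : E ↔ Fin m′
  E↔ = ↔-sym (↔-trans +↔⊎ (*↔× ⊎-↔ ↔-refl))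

  value : E → ℤ
  value e = + suc (toℕ (Inverse.to E↔ e))

  value≉0 : ∀ e → ¬ value e ≈ + 0
  value≉0 e = ≉0 z<s (s≤s (toℕ<n (Inverse.to E↔ e)))

  value-injective : ∀ {e e′} → value e ≈ value e′ → e ≡ e′
  value-injective p = ↔-injective E↔ (suc-injective (⟦⟧-injective {suc _} {suc _} p))

  class : ∀ a → ¬ a ≈ + 0 → ∃[ e ] value e ≈ a
  class a a≉0 with ρ a in eq
  ... | zero  = contradiction (ρ≡′⇒≈ {g = zero} eq) a≉0
  ... | suc f = Inverse.from E↔ f , ≈-trans
    (≈-reflexive (cong (λ f → + suc (toℕ f)) (Inverse.strictlyInverseˡ E↔ f)))
    (≈-sym (ρ≡′⇒≈ eq))

  neg-class : ∀ e → ∃[ e′ ] value e′ ≈ - value e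
  neg-class e = class (- value e) λ p → value≉0 e (linear₁ (- + 1) p
    (solve 1 (λ v → v :- con (+ 0) := con (- + 1) :* (:- v :- con (+ 0))) refl (value e)))

  -- `opposite j` is t - 1 - j, so the two cases are t - j and t + j + 1.
  shift : S → ℕ
  shift (inj₁ j) = suc (toℕ (opposite j))
  shift (inj₂ j) = suc (t + toℕ j)

  σ : S → ℤ
  σ s = + shift s

  -- With the first half reversed, the shifts run through 1 to 2t without repetition, which yields
  -- both the bound and injectivity.
  shift≡ : ∀ s → shift s ≡ suc (toℕ (join t t (Sum.map opposite id s)))
  shift≡ (inj₁ j) = cong suc (sym (toℕ-↑ˡ (opposite j) t))
  shift≡ (inj₂ j) = cong suc (sym (toℕ-↑ʳ t j))

  shift≤ : ∀ s → shift s ≤ t + t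
  shift≤ s rewrite shift≡ s = toℕ<n (join t t (Sum.map opposite id s))

  shift-injective : ∀ {s s′} → shift s ≡ shift s′ → s ≡ s′
  shift-injective {s} {s′} eq = reflect-injective (↔-injective (↔-sym +↔⊎) (toℕ-injective
    (ℕ.suc-injective (trans (sym (shift≡ s)) (trans eq (shift≡ s′))))))
    where
    opp-injective : ∀ {j j′ : Fin t} → opposite j ≡ opposite j′ → j ≡ j′
    opp-injective {j} {j′} eq =
      trans (sym (opposite-involutive j)) (trans (cong opposite eq) (opposite-involutive j′))
    reflect-injective : ∀ {s s′ : S} → Sum.map opposite id s ≡ Sum.map opposite id s′ → s ≡ s′
    reflect-injective {inj₁ _} {inj₁ _} eq = cong inj₁ (opp-injective (inj₁-injective eq))
    reflect-injective {inj₂ _} {inj₂ _} refl = refl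

  -- Two shifts sum to at most 4t, short of m = 4t + 3, so no shift is the negative of another.
  shifts< : ∀ s s′ → shift s + shift s′ < m
  shifts< s s′ = s≤s (≤-trans (+-mono-≤ (shift≤ s) (shift≤ s′))
    (subst (t + t + (t + t) ≤_) (lemma t) (m≤m+n _ 2)))
    where
    lemma : ∀ t → t + t + (t + t) + 2 ≡ t * 3 + (t + 2)
    lemma = ℕ-solve-∀

  shift>0 : ∀ s → 0 < shift s
  shift>0 (inj₁ _) = z<s
  shift>0 (inj₂ _) = z<s

  shift< : ∀ s → shift s < m
  shift< s = ≤-<-trans (m≤m+n _ _) (shifts< s s)

  U : ℤ
  U = + 3 ℤ.* T ℤ.+ + 1

  assign : E → S ⊎ O
  assign (inj₁ (j , 0F)) = inj₁ (inj₁ j)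
  assign (inj₁ (j , 1F)) = inj₂ (inj₁ j)
  assign (inj₁ (j , 2F)) = inj₁ (inj₂ j)
  assign (inj₂ k)        = inj₂ (inj₂ k)

  unassign : S ⊎ O → E
  unassign (inj₁ (inj₁ j)) = inj₁ (j , 0F)
  unassign (inj₂ (inj₁ j)) = inj₁ (j , 1F)
  unassign (inj₁ (inj₂ j)) = inj₁ (j , 2F)
  unassign (inj₂ (inj₂ k)) = inj₂ k

  unassign-assign : ∀ e → unassign (assign e) ≡ e
  unassign-assign (inj₁ (j , 0F)) = refl
  unassign-assign (inj₁ (j , 1F)) = refl
  unassign-assign (inj₁ (j , 2F)) = refl
  unassign-assign (inj₂ k)        = refl

  moves : Moves (Fin m) E S O
  moves = record
    { eq? = _≟_
    ; lo  = λ e g → ρ (⟦ g ⟧ - value e)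
    ; hi  = λ e g → ρ (⟦ g ⟧ ℤ.+ value e)
    ; neg = proj₁ ∘ neg-class
    ; sh  = λ s g → ρ (⟦ g ⟧ ℤ.+ σ s)
    ; up  = λ g → ρ (⟦ g ⟧ ℤ.+ U)
    ; κ   = assign
    ; ε   = unassign ∘ inj₁
    }

  open Moves moves hiding (eq?)

  lo-neg : ∀ e g → lo (neg e) g ≡ hi e g
  lo-neg e g = ≈⇒ρ≡ (linear₁ (- + 1) (proj₂ (neg-class e)) (solve 3 (λ g v n →
    (g :- n) :- (g :+ v) := con (- + 1) :* (n :- :- v)) refl ⟦ g ⟧ (value e) (value (neg e))))

  hi-neg : ∀ e g → hi (neg e) g ≡ lo e g
  hi-neg e g = ≈⇒ρ≡ (linear₁ (+ 1) (proj₂ (neg-class e)) (solve 3 (λ g v n →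
    (g :+ n) :- (g :- v) := con (+ 1) :* (n :- :- v)) refl ⟦ g ⟧ (value e) (value (neg e))))

  -- This is the oddness of `m`: otherwise 2e, and hence e, would vanish.
  neg≢ : ∀ e → neg e ≢ e
  neg≢ e eq = value≉0 e (halve (linear₁ (+ 1) v≈-v (solve 1 (λ v →
    con (+ 2) :* v :- con (+ 2) :* con (+ 0) := con (+ 1) :* (v :- :- v)) refl (value e))))
    where
    v≈-v : value e ≈ - value e
    v≈-v = subst (λ e′ → value e′ ≈ - value e) eq (proj₂ (neg-class e))

  lo≢ : ∀ {e g} → lo e g ≢ g
  lo≢ {e} {g} eq = value≉0 e (linear₁ (- + 1) (ρ≡′⇒≈ eq) (solve 2 (λ g v →
    v :- con (+ 0) := con (- + 1) :* ((g :- v) :- g)) refl ⟦ g ⟧ (value e)))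

  lo-injᵍ : ∀ {e g g′} → lo e g ≡ lo e g′ → g ≡ g′
  lo-injᵍ {e} {g} {g′} eq = ⟦⟧-injective (linear₁ (+ 1) (ρ≡⇒≈ eq)
    (solve 3 (λ g g′ v → g :- g′ := con (+ 1) :* ((g :- v) :- (g′ :- v))) refl ⟦ g ⟧ ⟦ g′ ⟧ (value e)))

  lo-injᵉ : ∀ {e e′ g} → lo e g ≡ lo e′ g → e ≡ e′
  lo-injᵉ {e} {e′} {g} eq = value-injective (linear₁ (- + 1) (ρ≡⇒≈ eq)
    (solve 3 (λ g v w → v :- w := con (- + 1) :* ((g :- v) :- (g :- w)))
      refl ⟦ g ⟧ (value e) (value e′)))

  diff≉0 : ∀ {a b : Fin m} → a ≢ b → ¬ ⟦ b ⟧ - ⟦ a ⟧ ≈ + 0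
  diff≉0 {a} {b} a≢b p = a≢b (⟦⟧-injective (linear₁ (- + 1) p (solve 2 (λ a b →
    a :- b := con (- + 1) :* ((b :- a) :- con (+ 0))) refl ⟦ a ⟧ ⟦ b ⟧)))

  diff : ∀ {a b} → a ≢ b → ∃[ e ] lo e b ≡ a
  diff {a} {b} a≢b with e , v≈ ← class (⟦ b ⟧ - ⟦ a ⟧) (diff≉0 a≢b) =
    e , ≈⇒ρ≡′ (linear₁ (- + 1) v≈ (solve 3 (λ a b v →
      (b :- v) :- a := con (- + 1) :* (v :- (b :- a))) refl ⟦ a ⟧ ⟦ b ⟧ (value e)))

  -- Doubled, both conclusions are linear in the hypotheses; `halve` removes the factor.
  half-sum : ∀ a b g v → + 2 ℤ.* g ≈ a ℤ.+ b → + 2 ℤ.* v ≈ b - a → g - v ≈ a × g ℤ.+ v ≈ b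
  half-sum a b g v 2g≈ 2v≈ =
    halve (linear₂ (+ 1) (- + 1) 2g≈ 2v≈ (solve 4 (λ a b g v →
      con (+ 2) :* (g :- v) :- con (+ 2) :* a :=
      con (+ 1) :* (con (+ 2) :* g :- (a :+ b)) :+ con (- + 1) :* (con (+ 2) :* v :- (b :- a)))
      refl a b g v)) ,
    halve (linear₂ (+ 1) (+ 1) 2g≈ 2v≈ (solve 4 (λ a b g v →
      con (+ 2) :* (g :+ v) :- con (+ 2) :* b :=
      con (+ 1) :* (con (+ 2) :* g :- (a :+ b)) :+ con (+ 1) :* (con (+ 2) :* v :- (b :- a)))
      refl a b g v))

  mid : ∀ {a b} → a ≢ b → ∃[ e ] ∃[ g ] lo e g ≡ a × hi e g ≡ b
  mid {a} {b} a≢b = e , g , ≈⇒ρ≡′ (proj₁ halves) , ≈⇒ρ≡′ (proj₂ halves)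
    where
    sum difference : ℤ
    sum = ⟦ a ⟧ ℤ.+ ⟦ b ⟧
    difference = ⟦ b ⟧ - ⟦ a ⟧
    half : ∃[ e ] value e ≈ ½ ℤ.* difference
    -- Half of a nonzero difference is nonzero, since doubling recovers it.
    half = class (½ ℤ.* difference) λ p →
      diff≉0 a≢b (≈-trans (≈-sym (2½≈ difference)) (≈-* (+ 2) p))
    e = proj₁ half
    g = ρ (½ ℤ.* sum)
    halves : ⟦ g ⟧ - value e ≈ ⟦ a ⟧ × ⟦ g ⟧ ℤ.+ value e ≈ ⟦ b ⟧
    halves = half-sum ⟦ a ⟧ ⟦ b ⟧ ⟦ g ⟧ (value e)
      (≈-trans (≈-* (+ 2) (⟦ρ⟧ (½ ℤ.* sum))) (2½≈ sum))
      (≈-trans (≈-* (+ 2) (proj₂ half)) (2½≈ difference))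

  mid-unique : ∀ {e e′ g g′} → lo e g ≡ lo e′ g′ → hi e g ≡ hi e′ g′ → e ≡ e′ × g ≡ g′
  mid-unique {e} {e′} {g} {g′} lo≡ hi≡ =
    value-injective (halve (linear₂ (+ 1) (- + 1) hi≈ lo≈ (solve 4 (λ v w g h →
      con (+ 2) :* v :- con (+ 2) :* w := con (+ 1) :* ((g :+ v) :- (h :+ w)) :+
      con (- + 1) :* ((g :- v) :- (h :- w))) refl (value e) (value e′) ⟦ g ⟧ ⟦ g′ ⟧))) ,
    ⟦⟧-injective (halve (linear₂ (+ 1) (+ 1) hi≈ lo≈ (solve 4 (λ v w g h →
      con (+ 2) :* g :- con (+ 2) :* h := con (+ 1) :* ((g :+ v) :- (h :+ w)) :+
      con (+ 1) :* ((g :- v) :- (h :- w))) refl (value e) (value e′) ⟦ g ⟧ ⟦ g′ ⟧)))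
    where
    lo≈ : ⟦ g ⟧ - value e ≈ ⟦ g′ ⟧ - value e′
    lo≈ = ρ≡⇒≈ lo≡
    hi≈ : ⟦ g ⟧ ℤ.+ value e ≈ ⟦ g′ ⟧ ℤ.+ value e′
    hi≈ = ρ≡⇒≈ hi≡

  κ-injective : Injective _≡_ _≡_ κ
  κ-injective {e} {e′} eq =
    trans (sym (unassign-assign e)) (trans (cong unassign eq) (unassign-assign e′))

  κ⇒ε : ∀ {e s} → κ e ≡ inj₁ s → e ≡ ε s
  κ⇒ε {e} eq = trans (sym (unassign-assign e)) (cong unassign eq)

  sh≢ : ∀ {s g} → sh s g ≢ g
  sh≢ {s} {g} eq = ≉0 (shift>0 s) (shift< s) (linear₁ (+ 1) (ρ≡′⇒≈ eq) (solve 2 (λ g v →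
    v :- con (+ 0) := con (+ 1) :* ((g :+ v) :- g)) refl ⟦ g ⟧ (σ s)))

  sh-injective : ∀ {s s′ g} → sh s g ≡ sh s′ g → s ≡ s′
  sh-injective {s} {s′} {g} eq = shift-injective (≈⇒≡ (shift< s) (shift< s′)
    (linear₁ (+ 1) (ρ≡⇒≈ eq)
    (solve 3 (λ g v w → v :- w := con (+ 1) :* ((g :+ v) :- (g :+ w))) refl ⟦ g ⟧ (σ s) (σ s′))))

  sh∘sh≢ : ∀ {s s′ g} → sh s (sh s′ g) ≢ g
  sh∘sh≢ {s} {s′} {g} eq = ≉0 (≤-trans (shift>0 s) (m≤m+n _ _)) (shifts< s s′)
    (linear₂ (+ 1) (- + 1) (ρ≡′⇒≈ eq) (⟦ρ⟧ (⟦ g ⟧ ℤ.+ σ s′)) (solve 4 (λ g h v w →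
      (v :+ w) :- con (+ 0) := con (+ 1) :* ((h :+ v) :- g) :+ con (- + 1) :* (h :- (g :+ w)))
      refl ⟦ g ⟧ ⟦ sh s′ g ⟧ (σ s) (σ s′)))

  up-injective : Injective _≡_ _≡_ up
  up-injective {g} {h} eq = ⟦⟧-injective (linear₁ (+ 1) (ρ≡⇒≈ eq)
    (solve 3 (λ g h u → g :- h := con (+ 1) :* ((g :+ u) :- (h :+ u))) refl ⟦ g ⟧ ⟦ h ⟧ U))

  -- Distinctness of the differences between adjacent rows.

  β τ : Mixed S → ℤ
  β (lower s) = - value (ε s)
  β (upper s) = value (ε s)
  β up⁺       = + 0
  β up⁻       = U
  τ (lower s) = σ s
  τ (upper s) = σ s
  τ up⁺       = U
  τ up⁻       = + 0

  +0≈ : ∀ a → a ≈ a ℤ.+ + 0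
  +0≈ a = ≈-reflexive (solve 1 (λ a → a := a :+ con (+ 0)) refl a)

  base≈ : ∀ d g → ⟦ base d g ⟧ ≈ ⟦ g ⟧ ℤ.+ β d
  base≈ (lower s) g = ⟦ρ⟧ _
  base≈ (upper s) g = ⟦ρ⟧ _
  base≈ up⁺       g = +0≈ ⟦ g ⟧
  base≈ up⁻       g = ⟦ρ⟧ _

  tip≈ : ∀ d g → ⟦ tip d g ⟧ ≈ ⟦ g ⟧ ℤ.+ τ d
  tip≈ (lower s) g = ⟦ρ⟧ _
  tip≈ (upper s) g = ⟦ρ⟧ _
  tip≈ up⁺       g = ⟦ρ⟧ _
  tip≈ up⁻       g = +0≈ ⟦ g ⟧

  -- The summands are consecutive intervals: [0, 2t), where parity separates two families; [2t, 3t);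
  -- the value 3t; [3t + 1, 4t + 1); and the values 4t + 1, 4t + 2.
  Code : Set
  Code = (Fin t × Fin 2) ⊎ (Fin t ⊎ (Fin 1 ⊎ (Fin t ⊎ Fin 2)))

  -- The differences s - e of `upper` decrease with j, so `opposite` puts them in increasing order.
  code : Mixed S → Code
  code (lower (inj₂ j)) = inj₁ (j , 0F)
  code (upper (inj₁ j)) = inj₁ (opposite j , 1F)
  code (lower (inj₁ j)) = inj₂ (inj₁ j)
  code up⁺              = inj₂ (inj₂ (inj₁ 0F))
  code (upper (inj₂ j)) = inj₂ (inj₂ (inj₂ (inj₁ (opposite j))))
  -- Solving 2χ + 1 - 3t = -u modulo m gives 4t + 2, the second of the last two values.
  code up⁻              = inj₂ (inj₂ (inj₂ (inj₂ 1F)))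

  decode : Code → Mixed S
  decode (inj₁ (j , 0F))                     = lower (inj₂ j)
  decode (inj₁ (j , 1F))                     = upper (inj₁ (opposite j))
  decode (inj₂ (inj₁ j))                     = lower (inj₁ j)
  decode (inj₂ (inj₂ (inj₁ _)))              = up⁺
  decode (inj₂ (inj₂ (inj₂ (inj₁ j))))       = upper (inj₂ (opposite j))
  decode (inj₂ (inj₂ (inj₂ (inj₂ _))))       = up⁻

  decode-code : ∀ d → decode (code d) ≡ d
  decode-code (lower (inj₂ j)) = refl
  decode-code (upper (inj₁ j)) = cong (upper ∘ inj₁) (opposite-involutive j)
  decode-code (lower (inj₁ j)) = refl
  decode-code up⁺              = refl
  decode-code (upper (inj₂ j)) = cong (upper ∘ inj₂) (opposite-involutive j)
  decode-code up⁻              = refl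

  Code↔ : Code ↔ Fin (t * 2 + (t + (1 + (t + 2))))
  Code↔ = ↔-sym (↔-trans +↔⊎ (*↔× ⊎-↔ ↔-trans +↔⊎ (↔-refl ⊎-↔ ↔-trans +↔⊎ (↔-refl ⊎-↔ +↔⊎))))

  -- Code↔ places the classes of differences in consecutive intervals of [0, m); the
  -- value 4t+1 is not taken.
  χ : Mixed S → ℕ
  χ d = toℕ (Inverse.to Code↔ (code d))

  χ<m : ∀ d → χ d < m
  χ<m d = subst (χ d <_) (lemma t) (toℕ<n (Inverse.to Code↔ (code d)))
    where
    lemma : ∀ t → t * 2 + (t + (1 + (t + 2))) ≡ suc (t * 3 + (t + 2))
    lemma = ℕ-solve-∀

  χ-injective : Injective _≡_ _≡_ χ
  χ-injective {d} {d′} eq = trans (sym (decode-code d))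
    (trans (cong decode (↔-injective Code↔ (toℕ-injective eq))) (decode-code d′))

  opposite≡ : ∀ j → + toℕ (opposite {t} j) ≡ T - + 1 - + toℕ j
  opposite≡ j = begin
    + o                         ≡⟨ solve 2 (λ o j → o := ((con (+ 1) :+ j) :+ o) :- con (+ 1) :- j)
                                     refl (+ o) (+ toℕ j) ⟩
    + (suc (toℕ j) + o) - + 1 - + toℕ j
                                ≡⟨ cong (λ n → + n - + 1 - + toℕ j) complement ⟩
    T - + 1 - + toℕ j           ∎
    where
    open ≡-Reasoning
    o = toℕ (opposite j)
    complement : suc (toℕ j) + o ≡ t
    complement = trans (cong (λ o → suc (toℕ j) + o) (opposite-prop j)) (m+[n∸m]≡n (toℕ<n j))

  σ-near : ∀ j → σ (inj₁ j) ≡ T - + toℕ j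
  σ-near j = trans (cong (λ a → + 1 ℤ.+ a) (opposite≡ j))
    (solve 2 (λ T j → con (+ 1) :+ (T :- con (+ 1) :- j) := T :- j) refl T (+ toℕ j))

  combine≡ : ∀ {k n} (j : Fin k) (c : Fin n) → + toℕ (combine j c) ≡ + n ℤ.* + toℕ j ℤ.+ + toℕ c
  combine≡ {n = n} j c = trans (cong +_ (toℕ-combine j c)) (cong (ℤ._+ + toℕ c) (pos-* n (toℕ j)))

  ↑ʳ≡ : ∀ k {n} (i : Fin n) → + toℕ (k ↑ʳ i) ≡ + k ℤ.+ + toℕ i
  ↑ʳ≡ k i = cong +_ (toℕ-↑ʳ k i)

  value≡ : ∀ j c → value (inj₁ (j , c)) ≡ + 1 ℤ.+ (+ 3 ℤ.* + toℕ j ℤ.+ + toℕ c)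
  value≡ j c = trans (cong (λ n → + suc n) (toℕ-↑ˡ (combine j c) (t + 2)))
    (cong (λ a → + 1 ℤ.+ a) (combine≡ j c))

  χ-low : ∀ j c → + toℕ (combine {t} {2} j c ↑ˡ (t + (1 + (t + 2)))) ≡ + 2 ℤ.* + toℕ j ℤ.+ + toℕ c
  χ-low j c = trans (cong +_ (toℕ-↑ˡ (combine j c) _)) (combine≡ j c)

  χ-high : ∀ (i : Fin (t + (1 + (t + 2)))) → + toℕ ((t * 2) ↑ʳ i) ≡ T ℤ.* + 2 ℤ.+ + toℕ i
  χ-high i = trans (↑ʳ≡ (t * 2) i) (cong (ℤ._+ + toℕ i) (pos-* t 2))

  χ-top : ∀ (i : Fin (1 + (t + 2))) → + toℕ ((t * 2) ↑ʳ (t ↑ʳ i)) ≡ T ℤ.* + 2 ℤ.+ (T ℤ.+ + toℕ i)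
  χ-top i = trans (χ-high (t ↑ʳ i)) (cong (λ a → T ℤ.* + 2 ℤ.+ a) (↑ʳ≡ t i))

  -- The relation w - b = 2χ + 1 - 3t solved for 2χ; keeping the factor 2 avoids `½`.
  gap : ℤ → ℤ → ℤ
  gap b w = (w - b) ℤ.+ (+ 3 ℤ.* T - + 1)

  2χ≈ : ∀ d → + 2 ℤ.* + χ d ≈ gap (β d) (τ d)
  2χ≈ = go
    where
    -- `c` is the multiple of m by which 2χ exceeds `gap` as an integer; it ranges from -1 to 2 over
    -- the cases below.
    via : ∀ d {x b w} c → + χ d ≡ x → β d ≡ b → τ d ≡ w →
          + 2 ℤ.* x - gap b w ≡ c ℤ.* (+ 4 ℤ.* T ℤ.+ + 3 - + 0) → + 2 ℤ.* + χ d ≈ gap (β d) (τ d)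
    via d c refl refl refl = linear₁ c 4T+3≈0
    go : ∀ d → + 2 ℤ.* + χ d ≈ gap (β d) (τ d)
    go d@(lower (inj₂ j)) = via d (- + 1) (χ-low j 0F) (cong -_ (value≡ j 2F)) refl
      (solve 2 (λ T j → con (+ 2) :* (con (+ 2) :* j :+ con (+ 0)) :-
        (((con (+ 1) :+ (T :+ j)) :- (:- (con (+ 1) :+ (con (+ 3) :* j :+ con (+ 2)))))
         :+ (con (+ 3) :* T :- con (+ 1)))
        := con (- + 1) :* ((con (+ 4) :* T :+ con (+ 3)) :- con (+ 0))) refl T (+ toℕ j))
    go d@(upper (inj₁ j)) = via d (+ 0)
      (trans (χ-low (opposite j) 1F) (cong (λ a → + 2 ℤ.* a ℤ.+ + 1) (opposite≡ j)))
      (value≡ j 0F) (σ-near j)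
      (solve 2 (λ T j → con (+ 2) :* (con (+ 2) :* (T :- con (+ 1) :- j) :+ con (+ 1)) :-
        (((T :- j) :- (con (+ 1) :+ (con (+ 3) :* j :+ con (+ 0))))
         :+ (con (+ 3) :* T :- con (+ 1)))
        := con (+ 0) :* ((con (+ 4) :* T :+ con (+ 3)) :- con (+ 0))) refl T (+ toℕ j))
    go d@(lower (inj₁ j)) = via d (+ 0)
      (trans (χ-high (j ↑ˡ _)) (cong (λ n → T ℤ.* + 2 ℤ.+ + n) (toℕ-↑ˡ j _)))
      (cong -_ (value≡ j 0F)) (σ-near j)
      (solve 2 (λ T j → con (+ 2) :* (T :* con (+ 2) :+ j) :-
        (((T :- j) :- (:- (con (+ 1) :+ (con (+ 3) :* j :+ con (+ 0)))))
         :+ (con (+ 3) :* T :- con (+ 1)))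
        := con (+ 0) :* ((con (+ 4) :* T :+ con (+ 3)) :- con (+ 0))) refl T (+ toℕ j))
    go d@up⁺ = via d (+ 0) (χ-top 0F) refl refl
      (solve 1 (λ T → con (+ 2) :* (T :* con (+ 2) :+ (T :+ con (+ 0))) :-
        (((con (+ 3) :* T :+ con (+ 1)) :- con (+ 0))
         :+ (con (+ 3) :* T :- con (+ 1)))
        := con (+ 0) :* ((con (+ 4) :* T :+ con (+ 3)) :- con (+ 0))) refl T)
    go d@(upper (inj₂ j)) = via d (+ 1)
      (trans (χ-top (suc (opposite j ↑ˡ 2)))
        (cong (λ a → T ℤ.* + 2 ℤ.+ (T ℤ.+ (+ 1 ℤ.+ a)))
          (trans (cong +_ (toℕ-↑ˡ (opposite j) 2)) (opposite≡ j))))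
      (value≡ j 2F) refl
      (solve 2 (λ T j → con (+ 2) :* (T :* con (+ 2) :+ (T :+ (con (+ 1) :+ (T :- con (+ 1) :- j)))) :-
        (((con (+ 1) :+ (T :+ j)) :- (con (+ 1) :+ (con (+ 3) :* j :+ con (+ 2))))
         :+ (con (+ 3) :* T :- con (+ 1)))
        := con (+ 1) :* ((con (+ 4) :* T :+ con (+ 3)) :- con (+ 0))) refl T (+ toℕ j))
    go d@up⁻ = via d (+ 2)
      (trans (χ-top (suc (t ↑ʳ 1F))) (cong (λ a → T ℤ.* + 2 ℤ.+ (T ℤ.+ (+ 1 ℤ.+ a))) (↑ʳ≡ t 1F)))
      refl refl
      (solve 1 (λ T → con (+ 2) :* (T :* con (+ 2) :+ (T :+ (con (+ 1) :+ (T :+ con (+ 1))))) :-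
        ((con (+ 0) :- (con (+ 3) :* T :+ con (+ 1)))
         :+ (con (+ 3) :* T :- con (+ 1)))
        := con (+ 2) :* ((con (+ 4) :* T :+ con (+ 3)) :- con (+ 0))) refl T)

  -- Subtracting base from tip cancels the column, so both labels have the same `gap`. Then `halve`
  -- makes their `χ` congruent, and both lie below m, so the labels agree; the base now gives the
  -- column.
  mixed-unique : ∀ d d′ {g g′} → base d g ≡ base d′ g′ → tip d g ≡ tip d′ g′ → d ≡ d′ × g ≡ g′
  mixed-unique d d′ {g} {g′} base≡ tip≡ = d≡d′ , columns d≡d′ base+
    where
    base+ : ⟦ g ⟧ ℤ.+ β d ≈ ⟦ g′ ⟧ ℤ.+ β d′
    base+ = ≈-trans (≈-sym (base≈ d g)) (≈-trans (≈-reflexive (cong ⟦_⟧ base≡)) (base≈ d′ g′))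
    tip+ : ⟦ g ⟧ ℤ.+ τ d ≈ ⟦ g′ ⟧ ℤ.+ τ d′
    tip+ = ≈-trans (≈-sym (tip≈ d g)) (≈-trans (≈-reflexive (cong ⟦_⟧ tip≡)) (tip≈ d′ g′))
    gap≈ : gap (β d) (τ d) ≈ gap (β d′) (τ d′)
    gap≈ = linear₂ (+ 1) (- + 1) tip+ base+ (solve 7 (λ g h b c w x k →
      ((w :- b) :+ k) :- ((x :- c) :+ k) := con (+ 1) :* ((g :+ w) :- (h :+ x)) :+
      con (- + 1) :* ((g :+ b) :- (h :+ c)))
      refl ⟦ g ⟧ ⟦ g′ ⟧ (β d) (β d′) (τ d) (τ d′) (+ 3 ℤ.* T - + 1))
    d≡d′ : d ≡ d′
    d≡d′ = χ-injective (≈⇒≡ (χ<m d) (χ<m d′)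
      (halve (≈-trans (2χ≈ d) (≈-trans gap≈ (≈-sym (2χ≈ d′))))))
    columns : ∀ {d′} → d ≡ d′ → ⟦ g ⟧ ℤ.+ β d ≈ ⟦ g′ ⟧ ℤ.+ β d′ → g ≡ g′
    columns refl p = ⟦⟧-injective (linear₁ (+ 1) p (solve 3 (λ g h b →
      g :- h := con (+ 1) :* ((g :+ b) :- (h :+ b))) refl ⟦ g ⟧ ⟦ g′ ⟧ (β d)))

  columns : Columns (Fin m) E S O
  columns = record
    { moves        = moves
    ; lo-neg       = lo-neg
    ; hi-neg       = hi-neg
    ; neg≢         = neg≢
    ; lo≢          = λ {e} {g} → lo≢ {e} {g}
    ; lo-injᵍ      = λ {e} {g} {g′} → lo-injᵍ {e} {g} {g′}
    ; lo-injᵉ      = λ {e} {e′} {g} → lo-injᵉ {e} {e′} {g}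
    ; diff         = diff
    ; mid          = mid
    ; mid-unique   = λ {e} {e′} {g} {g′} → mid-unique {e} {e′} {g} {g′}
    ; κ-injective  = κ-injective
    ; κ⇒ε          = κ⇒ε
    ; sh≢          = λ {s} {g} → sh≢ {s} {g}
    ; sh-injective = λ {s} {s′} {g} → sh-injective {s} {s′} {g}
    ; sh∘sh≢       = λ {s} {s′} {g} → sh∘sh≢ {s} {s′} {g}
    ; up-injective = up-injective
    ; mixed-unique = mixed-unique
    }

  -- Enumeration of points and blocks, and the parameters.

  open Construction columns using (pts; ψ; nesting; Point; Index)

  Point↔ : Point ↔ Fin (1 + m * 3)
  Point↔ = ↔-sym (↔-trans +↔⊎ (1↔⊤ ⊎-↔ *↔×))

  Outer↔ : (O ⊎ Unit) ↔ Fin ((t + (t + 2)) + 1)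
  Outer↔ = ↔-sym (↔-trans +↔⊎ (+↔⊎ ⊎-↔ 1↔⊤))

  Index↔ : Index ↔ Fin (m * (3 * m′) + (m * 3 + m))
  Index↔ = ↔-sym (↔-trans +↔⊎
    (↔-trans *↔× (↔-refl ×-↔ ↔-trans *↔× (↔-refl ×-↔ ↔-sym E↔)) ⊎-↔ ↔-trans +↔⊎ (*↔× ⊎-↔ ↔-refl)))

  open Labelled.Realise pts ψ Point↔ Outer↔ Index↔ nesting public
    using (X; 𝒜; φ; isWeakNesting)

theorem3p6 : (t : ℕ) → 2 ≤ t →
    Σ[ n ∈ ℕ ] Σ[ b ∈ ℕ ] Σ[ X ∈ Subset n ] Σ[ Y ∈ Subset n ]
    Σ[ 𝒜 ∈ Blocks n b ] Σ[ φ ∈ (Fin b → Fin n) ]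
    IsWeakNesting (12 * t + 10) (14 * t + 13) 3 2 X Y 𝒜 φ
theorem3p6 t _ = _ , _ , _ , _ , _ , _ ,
  -- There are 3m + 1 = 12t + 10 old points and 2t + 3 new ones; Y is the whole ambient set.
  subst₂ (λ v w → IsWeakNesting v w 3 2 X ⊤ 𝒜 φ) (v≡ t) (w≡ t) isWeakNesting
  where
  open Cyclic t
  v≡ : ∀ t → 1 + suc (t * 3 + (t + 2)) * 3 ≡ 12 * t + 10
  v≡ = ℕ-solve-∀
  w≡ : ∀ t → 1 + suc (t * 3 + (t + 2)) * 3 + (t + (t + 2) + 1) ≡ 14 * t + 13
  w≡ = ℕ-solve-∀
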